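{- Let $n\ge 2$. For every set $\Gamma\cup\{\varphi\}\subseteq For(\Sigma^{C_1}_D)$, if $\Gamma\vDash_{C^D_n}\varphi$, then $\Gamma\vdash_{C^D_n}\varphi$.
   Context: **Syntax.** $For(\Sigma^{C_1}_D)$ is the set of formulas generated from a denumerable set of propositional variables by the signature $\Sigma^{C_1}_D=\{\to,\neg,\lor,\land,\mathsf{O}\}$ ($\neg,\mathsf{O}$ unary; $\to,\lor,\land$ binary). Abbreviations: $\alpha^0:=\alpha$; $\alpha^{k+1}:=\neg(\alpha^k\land\neg\alpha^k)$; $\alpha^{(n)}:=\alpha^1\land\dots\land\alpha^n$; ${\sim}^{(n)}\alpha:=\neg\alpha\land\alpha^{(n)}$. **The logic $C^D_n$.** Hilbert calculus whose axiom schemas are those of $CPL^+$, the positive fragment of classical propositional logic in $\to,\land,\lor$ (for instance: $\alpha\to(\beta\to\alpha)$; $(\alpha\to(\beta\to\gamma))\to((\alpha\to\beta)\to(\alpha\to\gamma))$; $\alpha\to(\beta\to(\alpha\land\beta))$; $(\alpha\land\beta)\to\alpha$; $(\alpha\land\beta)\to\beta$; $\alpha\to(\alpha\lor\beta)$; $\beta\to(\alpha\lor\beta)$; $(\alpha\to\gamma)\to((\beta\to\gamma)\to((\alpha\lor\beta)\to\gamma))$; $\alpha\lor(\alpha\to\beta)$), plus - (EM) $\alpha\lor\neg\alpha$; (cf) $\neg\neg\alpha\to\alpha$; - (bc$_n$) $\alpha^{(n)}\to(\alpha\to(\neg\alpha\to\beta))$; - (P$_n$) $(\alpha^{(n)}\land\beta^{(n)})\to((\alpha\to\beta)^{(n)}\land(\alpha\lor\beta)^{(n)}\land(\alpha\land\beta)^{(n)})$;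 - (K) $\mathsf{O}(\alpha\to\beta)\to(\mathsf{O}\alpha\to\mathsf{O}\beta)$; - (D$_n$) $\mathsf{O}\alpha\to{\sim}^{(n)}\mathsf{O}{\sim}^{(n)}\alpha$; - (P$\mathsf{O}_n$) $\alpha^{(n)}\to(\mathsf{O}\alpha)^{(n)}$. The rules are Modus Ponens and $\mathsf{O}$-necessitation (from $\varphi$ infer $\mathsf{O}\varphi$). $\vdash_{C^D_n}\varphi$ means that there is a finite derivation of $\varphi$ from axioms (no premises) using the rules. $\Gamma\vdash_{C^D_n}\varphi$ means: either $\vdash_{C^D_n}\varphi$, or there are $\gamma_1,\dots,\gamma_k\in\Gamma$ ($k\ge1$ finite) with $\vdash_{C^D_n}(\gamma_1\land\dots\land\gamma_k)\to\varphi$. **Truth values.** $A_n=\{z\in\{0,1\}^{n+1}: (\bigwedge_{i\le k}z_i)\lor z_{k+1}=1\text{ for every }1\le k\le n\}$. It has exactly $n+2$ elements: $T_n=(1,0,1,\dots,1)$; $F_n=(0,1,\dots,1)$; for $0\le i\le n-2$, $t^n_i$ is the tuple whose only $0$ is in position $i+3$; and $t^n_{n-1}=(1,\dots,1)$. Put $D_n=A_n\setminus\{F_n\}$, $I_n=A_n\setminus\{T_n,F_n\}$, $Boo_n=\{T_n,F_n\}$. **Multioperations.** With $\sqcap,\sqcup,\supset$ the Boolean meet, join, implication on $\{0,1\}$ and $\bigwedge$ the meet of a non-empty subset of $\{0,1\}$, for $a,b\in A_n$ and $\emptyset\ne X\subseteq A_n$: - $\tilde\neg a=\{c\in A_n: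 c_1=a_2\text{ and }c_2\le a_1\}$; - for $\#\in\{\land,\lor,\to\}$ with corresponding Boolean operation $\ast\in\{\sqcap,\sqcup,\supset\}$: $a\,\tilde\#\,b=\{c\in Boo_n:c_1=a_1\ast b_1\}$ if $a,b\in Boo_n$, and $a\,\tilde\#\,b=\{c\in A_n:c_1=a_1\ast b_1\}$ otherwise; - $\tilde{\mathsf{O}}(X)=\{c\in A_n:c_1=\bigwedge\{x_1:x\in X\}\}$. **Models.** A swap Kripke model for $C^D_n$ is a triple $(W,R,\{v^n_w\}_{w\in W})$ with $W\neq\emptyset$, $R\subseteq W\times W$ serial (every $w$ has some $w'$ with $wRw'$), and functions $v^n_w:For(\Sigma^{C_1}_D)\to A_n$ such that for all $\alpha,\beta$ and $w$: - $v^n_w(\neg\alpha)\in\tilde\neg v^n_w(\alpha)$; $v^n_w(\alpha\#\beta)\in v^n_w(\alpha)\,\tilde\#\,v^n_w(\beta)$ for $\#\in\{\land,\lor,\to\}$; $v^n_w(\mathsf{O}\alpha)\in\tilde{\mathsf{O}}(\{v^n_{w'}(\alpha):wRw'\})$; - $v^n_w(\alpha)=t^n_0$ implies $v^n_w(\alpha\land\neg\alpha)=T_n$; - for $1\le k\le n-1$: $v^n_w(\alpha)=t^n_k$ implies $v^n_w(\alpha\land\neg\alpha)\in I_n$ and $v^n_w(\alpha^1)=t^n_{k-1}$; - if $v^n_w(\alpha)\in Boo_n$ then $v^n_w(\mathsf{O}\alpha)\in Boo_n$. $\mathcal{M},w\vDash\alpha$ means $v^n_w(\alpha)\in D_n$;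 $\mathcal{M},w\vDash\Gamma$ means $\mathcal{M},w\vDash\gamma$ for all $\gamma\in\Gamma$. $\Gamma\vDash_{C^D_n}\alpha$ means: for every swap Kripke model $\mathcal{M}$ for $C^D_n$ and every world $w$ in it, $\mathcal{M},w\vDash\Gamma$ implies $\mathcal{M},w\vDash\alpha$. -}

module Defs where

open import Data.Bool as Bool using (Bool; true; false; if_then_else_)
open import Data.Bool.ListAction using (and)
open import Data.Fin as Fin using (Fin; toℕ; fromℕ<)
import Data.List as List
open import Data.List.NonEmpty using (List⁺; foldl₁)
open import Data.List.NonEmpty.Relation.Unary.All using (All)
open import Data.Nat using (ℕ; zero; suc; _≤_; _<_; _≡ᵇ_; s≤s)
open import Data.Nat.Properties using (<⇒≤)
open import Data.Product using (∃; _×_; _,_)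
open import Data.Sum using (_⊎_)
open import Data.Vec using (Vec; head; lookup; tabulate; toList)
open import Data.Vec.Properties using (≡-dec)
open import Level using (0ℓ)
open import Relation.Binary using (Rel)
open import Relation.Binary.PropositionalEquality using (_≡_; _≢_)
open import Relation.Nullary using (does; _×-dec_; _⊎-dec_)
open import Relation.Unary using (Pred; Decidable; _∈_; Satisfiable)

infix  9 _^_ _^⟨_⟩
infix  8 ¬_ O_ ∼⟨_⟩_
infixl 7 _∧_
infixl 6 _∨_
infixr 5 _⇒_
infix  4 ⊢[_]_ _⊢[_]_

data Formula : Set where
  var         : ℕ → Formula
  ¬_ O_       : Formula → Formula
  _∧_ _∨_ _⇒_ : Formula → Formula → Formula

_^_ : Formula → ℕ → Formula
α ^ zero  = α
α ^ suc k = ¬ (α ^ k ∧ ¬ (α ^ k))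

-- α ^⟨ n ⟩ is α ^ 1 ∧ … ∧ α ^ n, associated to the left.  It is only meant
-- for n ≥ 1; the clause for 0 is a filler.
_^⟨_⟩ : Formula → ℕ → Formula
α ^⟨ zero ⟩        = α ⇒ α
α ^⟨ suc zero ⟩    = α ^ 1
α ^⟨ suc (suc m) ⟩ = α ^⟨ suc m ⟩ ∧ α ^ suc (suc m)

∼⟨_⟩_ : ℕ → Formula → Formula
∼⟨ n ⟩ α = ¬ α ∧ α ^⟨ n ⟩

⋀ : List⁺ Formula → Formula
⋀ = foldl₁ _∧_

data Axiom (n : ℕ) : Pred Formula 0ℓ where
  ax-K   : ∀ α β   → Axiom n (α ⇒ β ⇒ α)
  ax-S   : ∀ α β γ → Axiom n ((α ⇒ β ⇒ γ) ⇒ (α ⇒ β) ⇒ α ⇒ γ)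
  ax-∧I  : ∀ α β   → Axiom n (α ⇒ β ⇒ α ∧ β)
  ax-∧E₁ : ∀ α β   → Axiom n (α ∧ β ⇒ α)
  ax-∧E₂ : ∀ α β   → Axiom n (α ∧ β ⇒ β)
  ax-∨I₁ : ∀ α β   → Axiom n (α ⇒ α ∨ β)
  ax-∨I₂ : ∀ α β   → Axiom n (β ⇒ α ∨ β)
  ax-∨E  : ∀ α β γ → Axiom n ((α ⇒ γ) ⇒ (β ⇒ γ) ⇒ α ∨ β ⇒ γ)
  ax-∨⇒  : ∀ α β   → Axiom n (α ∨ (α ⇒ β))
  EM     : ∀ α     → Axiom n (α ∨ ¬ α)
  cf     : ∀ α     → Axiom n (¬ ¬ α ⇒ α)
  bc     : ∀ α β   → Axiom n (α ^⟨ n ⟩ ⇒ α ⇒ ¬ α ⇒ β)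
  P      : ∀ α β   → Axiom n (α ^⟨ n ⟩ ∧ β ^⟨ n ⟩ ⇒
                              (α ⇒ β) ^⟨ n ⟩ ∧ (α ∨ β) ^⟨ n ⟩ ∧ (α ∧ β) ^⟨ n ⟩)
  K      : ∀ α β   → Axiom n (O (α ⇒ β) ⇒ O α ⇒ O β)
  D      : ∀ α     → Axiom n (O α ⇒ ∼⟨ n ⟩ O (∼⟨ n ⟩ α))
  PO     : ∀ α     → Axiom n (α ^⟨ n ⟩ ⇒ (O α) ^⟨ n ⟩)

data ⊢[_]_ (n : ℕ) : Pred Formula 0ℓ where
  axiom : ∀ {φ}   → Axiom n φ → ⊢[ n ] φ
  MP    : ∀ {φ ψ} → ⊢[ n ] (φ ⇒ ψ) → ⊢[ n ] φ → ⊢[ n ] ψ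
  O-nec : ∀ {φ}   → ⊢[ n ] φ → ⊢[ n ] (O φ)

_⊢[_]_ : Pred Formula 0ℓ → ℕ → Formula → Set
Γ ⊢[ n ] φ = (⊢[ n ] φ) ⊎ ∃ λ (γs : List⁺ Formula) → All (_∈ Γ) γs × ⊢[ n ] (⋀ γs ⇒ φ)

IsMeet : Pred Bool 0ℓ → Bool → Set
IsMeet S b = (∀ {s} → s ∈ S → b Bool.≤ s)
           × (∀ {l} → (∀ {s} → s ∈ S → l Bool.≤ s) → l Bool.≤ b)

_⊃_ : Bool → Bool → Bool
a ⊃ b = Bool.not a Bool.∨ b

-- Coordinates of tuples are numbered from 0 here, so zᵢ in the usual 1-based
-- numbering is the coordinate of index i - 1.
module Semantics (n : ℕ) (2≤n : 2 ≤ n) where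

  Tuple : Set
  Tuple = Vec Bool (suc n)

  first second : Tuple → Bool
  first    = head
  second a = lookup a (fromℕ< (s≤s (<⇒≤ 2≤n)))

  -- With k′ = suc (toℕ k) ranging over 1, …, n, the condition reads
  -- (z₁ ∧ … ∧ z_k′) ∨ z_(k′+1) = 1 in 1-based numbering.
  A : Pred Tuple 0ℓ
  A z = (k : Fin n) →
    and (List.take (suc (toℕ k)) (toList z)) Bool.∨ lookup z (Fin.suc k) ≡ true

  -- The tuple whose only 0 has index m; constantly 1 when m > n.
  zeroAt : ℕ → Tuple
  zeroAt m = tabulate λ j → Bool.not (toℕ j ≡ᵇ m)

  T F : Tuple
  T = zeroAt 1
  F = zeroAt 0

  -- Meant for 0 ≤ i ≤ n - 1; in particular t (n - 1) = (1, …, 1).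
  t : ℕ → Tuple
  t i = zeroAt (suc (suc i))

  Designated Inconsistent Boo : Pred Tuple 0ℓ
  Designated   a = a ∈ A × a ≢ F
  Inconsistent a = a ∈ A × a ≢ T × a ≢ F
  Boo          a = a ≡ T ⊎ a ≡ F

  Boo? : Decidable Boo
  Boo? a = ≡-dec Bool._≟_ a T ⊎-dec ≡-dec Bool._≟_ a F

  ¬̃_ : Tuple → Pred Tuple 0ℓ
  (¬̃ a) c = c ∈ A × first c ≡ second a × second c Bool.≤ first a

  multi : (Bool → Bool → Bool) → Tuple → Tuple → Pred Tuple 0ℓ
  multi _∗_ a b c =
    c ∈ (if does (Boo? a ×-dec Boo? b) then Boo else A) × first c ≡ first a ∗ first b

  _∧̃_ _∨̃_ _⇒̃_ : Tuple → Tuple → Pred Tuple 0ℓ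
  _∧̃_ = multi Bool._∧_
  _∨̃_ = multi Bool._∨_
  _⇒̃_ = multi _⊃_

  Õ : Pred Tuple 0ℓ → Pred Tuple 0ℓ
  Õ X c = c ∈ A × IsMeet (λ b → ∃ λ x → x ∈ X × b ≡ first x) (first c)

  record Model : Set₁ where
    field
      W        : Set
      nonempty : W
      R        : Rel W 0ℓ
      serial   : ∀ w → Satisfiable (R w)
      v        : W → Formula → Tuple
      v∈A      : ∀ w α → v w α ∈ A
      v-¬      : ∀ w α → v w (¬ α) ∈ (¬̃ v w α)
      v-∧      : ∀ w α β → v w (α ∧ β) ∈ (v w α ∧̃ v w β)
      v-∨      : ∀ w α β → v w (α ∨ β) ∈ (v w α ∨̃ v w β)
      v-⇒      : ∀ w α β → v w (α ⇒ β) ∈ (v w α ⇒̃ v w β)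
      v-O      : ∀ w α → v w (O α) ∈ Õ (λ x → ∃ λ w′ → R w w′ × x ≡ v w′ α)
      v-t₀     : ∀ w α → v w α ≡ t 0 → v w (α ∧ ¬ α) ≡ T
      v-tₖ     : ∀ w α k → suc k < n → v w α ≡ t (suc k) →
                 v w (α ∧ ¬ α) ∈ Inconsistent × v w (α ^ 1) ≡ t k
      v-Boo    : ∀ w α → v w α ∈ Boo → v w (O α) ∈ Boo

  _,_⊩_ : (M : Model) → Model.W M → Formula → Set
  M , w ⊩ α = Model.v M w α ∈ Designated

  _⊨_ : Pred Formula 0ℓ → Formula → Set₁
  Γ ⊨ φ = (M : Model) (w : Model.W M) → (∀ γ → γ ∈ Γ → M , w ⊩ γ) → M , w ⊩ φ

{-# OPTIONS --safe #-}
-- The model is canonical.  Its worlds are the prime nontrivial theories, and the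
-- value of α at w records which of α, ¬ α, α ^ 1, …, α ^ (n ∸ 1) belong to w.
-- By EM and cf, w misses at most one formula of the infinite sequence
-- α, ¬ α, α ^ 1, α ^ 2, …, so that a value is determined by the position of the
-- missing formula; α has a Boolean value exactly when α and ¬ α are not both in w.
module Submission where

open import Defs
open import Axiom.ExcludedMiddle using (ExcludedMiddle)
open import Data.Bool as Bool using (Bool; true; false; not; if_then_else_)
import Data.Bool.Properties as Bool
open import Data.Bool.ListAction using (and)
open import Data.Fin as Fin using (Fin; toℕ; fromℕ<)
open import Data.Fin.Properties using (toℕ-fromℕ<)
open import Data.List as List using (List; []; _∷_; _++_; foldl; map; cartesianProductWith)
open import Data.List.Membership.Propositional using () renaming (_∈_ to _∈ₗ_)
open import Data.List.Membership.Propositional.Properties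
  using (∈-++⁺ˡ; ∈-++⁺ʳ; ∈-map⁺; ∈-cartesianProductWith⁺; ∈-upTo⁺)
open import Data.List.NonEmpty using (_∷_)
open import Data.List.NonEmpty.Relation.Unary.All using (_∷_)
open import Data.List.Relation.Unary.All using (All; []; _∷_)
open import Data.List.Relation.Unary.All.Properties using (++⁺)
open import Data.List.Relation.Unary.Any using (here; there)
open import Data.Nat using (ℕ; zero; suc; _≤_; _<_; _⊔_; _≡ᵇ_; z≤n; s≤s; s≤s⁻¹; _≤?_)
open import Data.Nat.Properties
open import Data.Product using (∃; _×_; _,_; proj₁; proj₂)
open import Data.Sum as Sum using (_⊎_; inj₁; inj₂; [_,_]′)
open import Data.Vec using (head; lookup; tabulate; toList)
open import Data.Vec.Properties using (tabulate-cong; lookup∘tabulate)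
open import Function using (_∘_; id; case_of_)
open import Level using (0ℓ)
open import Relation.Binary.Definitions using (tri<; tri≈; tri>)
open import Relation.Binary.PropositionalEquality
  using (_≡_; _≢_; refl; sym; trans; cong; subst)
open import Relation.Nullary as Nullary using (does; yes; no; contradiction; _×-dec_)
open import Relation.Nullary.Decidable using (dec-true; dec-false)
open import Relation.Unary using (Pred; _⊆_; _∈_; _∉_; _∪_; ∅; ｛_｝)

-- Relates the powers recorded in the value of `α ^ 1` to those recorded one place later in the
-- value of `α`.
^-suc : ∀ α k → (α ^ 1) ^ k ≡ α ^ suc k
^-suc α zero    = refl
^-suc α (suc k) = cong (λ β → ¬ (β ∧ ¬ β)) (^-suc α k)

-- Derivability from premises and the deduction theorem

module Derivations (n : ℕ) where

  infix 4 _⊢_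

  -- Necessitation enters only through `thm`, so it never applies to premises and the deduction
  -- theorem holds.
  data _⊢_ (Γ : Pred Formula 0ℓ) : Pred Formula 0ℓ where
    hyp : ∀ {φ}   → φ ∈ Γ → Γ ⊢ φ
    thm : ∀ {φ}   → ⊢[ n ] φ → Γ ⊢ φ
    mp  : ∀ {φ ψ} → Γ ⊢ φ ⇒ ψ → Γ ⊢ φ → Γ ⊢ ψ

  ax : ∀ {Γ φ} → Axiom n φ → Γ ⊢ φ
  ax = thm ∘ axiom

  cut : ∀ {Γ Δ} → Γ ⊆ (Δ ⊢_) → (Γ ⊢_) ⊆ (Δ ⊢_)
  cut σ (hyp p)  = σ p
  cut σ (thm t)  = thm t
  cut σ (mp d e) = mp (cut σ d) (cut σ e)

  weaken : ∀ {Γ Δ} → Γ ⊆ Δ → (Γ ⊢_) ⊆ (Δ ⊢_)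
  weaken Γ⊆Δ = cut (hyp ∘ Γ⊆Δ)

  ∅⊢⇒⊢ : ∀ {φ} → ∅ ⊢ φ → ⊢[ n ] φ
  ∅⊢⇒⊢ (thm t)  = t
  ∅⊢⇒⊢ (mp d e) = MP (∅⊢⇒⊢ d) (∅⊢⇒⊢ e)

  deduction : ∀ {Γ α β} → Γ ∪ ｛ α ｝ ⊢ β → Γ ⊢ α ⇒ β
  deduction (hyp (inj₁ p))    = mp (ax (ax-K _ _)) (hyp p)
  deduction {α = α} (hyp (inj₂ refl)) =
    mp (mp (ax (ax-S α (α ⇒ α) α)) (ax (ax-K _ _))) (ax (ax-K _ _))
  deduction (thm t)           = mp (ax (ax-K _ _)) (thm t)
  deduction (mp d e)          = mp (mp (ax (ax-S _ _ _)) (deduction d)) (deduction e)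

  finite-support : ∀ {Γ φ} → Γ ⊢ φ → ∃ λ γs → All (_∈ Γ) γs × (_∈ₗ γs) ⊢ φ
  finite-support (hyp {φ} p) = φ ∷ [] , p ∷ [] , hyp (here refl)
  finite-support (thm t)     = [] , [] , thm t
  finite-support (mp d e) with finite-support d | finite-support e
  ... | γs , γs⊆Γ , d′ | δs , δs⊆Γ , e′ =
    γs ++ δs , ++⁺ γs⊆Γ δs⊆Γ , mp (weaken ∈-++⁺ˡ d′) (weaken (∈-++⁺ʳ γs) e′)

  -- `⋀` nests to the left, so the induction merges the second formula into the head and keeps the
  -- head general.
  ⋀-elim : ∀ {Γ} γ γs → Γ ⊢ ⋀ (γ ∷ γs) → (_∈ₗ γ ∷ γs) ⊆ (Γ ⊢_)
  ⋀-elim γ []       d (here refl)         = d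
  ⋀-elim γ (δ ∷ γs) d (here refl)         = mp (ax (ax-∧E₁ _ _)) (⋀-elim (γ ∧ δ) γs d (here refl))
  ⋀-elim γ (δ ∷ γs) d (there (here refl)) = mp (ax (ax-∧E₂ _ _)) (⋀-elim (γ ∧ δ) γs d (here refl))
  ⋀-elim γ (δ ∷ γs) d (there (there p))   = ⋀-elim (γ ∧ δ) γs d (there p)

  ⊢⇒⊢[] : ∀ {Γ φ} → Γ ⊢ φ → Γ ⊢[ n ] φ
  ⊢⇒⊢[] d with finite-support d
  ... | []     , _         , d′ = inj₁ (∅⊢⇒⊢ (cut (λ ()) d′))
  ... | γ ∷ γs , γ∈Γ ∷ γs⊆Γ , d′ =
    inj₂ (γ ∷ γs , γ∈Γ ∷ γs⊆Γ , ∅⊢⇒⊢ (deduction (cut (⋀-elim γ γs (hyp (inj₂ refl))) d′)))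

-- Exhausting the formulas by finite lists

rank : Formula → ℕ
rank (var i) = suc i
rank (¬ α)   = suc (rank α)
rank (O α)   = suc (rank α)
rank (α ∧ β) = suc (rank α ⊔ rank β)
rank (α ∨ β) = suc (rank α ⊔ rank β)
rank (α ⇒ β) = suc (rank α ⊔ rank β)

formulas≤ : ℕ → List Formula
formulas≤ zero    = []
formulas≤ (suc k) =
  map var (List.upTo (suc k)) ++ map ¬_ L ++ map O_ L ++
  cartesianProductWith _∧_ L L ++ cartesianProductWith _∨_ L L ++ cartesianProductWith _⇒_ L L
  where L = formulas≤ k

∈-formulas≤ : ∀ α k → rank α ≤ k → α ∈ₗ formulas≤ k
∈-formulas≤ (var i) (suc k) i<k = ∈-++⁺ˡ (∈-map⁺ var (∈-upTo⁺ i<k))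
∈-formulas≤ (¬ α) (suc k) (s≤s r) =
  ∈-++⁺ʳ (map var (List.upTo (suc k))) (∈-++⁺ˡ (∈-map⁺ ¬_ (∈-formulas≤ α k r)))
∈-formulas≤ (O α) (suc k) (s≤s r) =
  ∈-++⁺ʳ (map var (List.upTo (suc k))) (∈-++⁺ʳ (map ¬_ (formulas≤ k))
    (∈-++⁺ˡ (∈-map⁺ O_ (∈-formulas≤ α k r))))
∈-formulas≤ (α ∧ β) (suc k) (s≤s r) =
  ∈-++⁺ʳ (map var (List.upTo (suc k))) (∈-++⁺ʳ (map ¬_ L) (∈-++⁺ʳ (map O_ L)
    (∈-++⁺ˡ (∈-cartesianProductWith⁺ _∧_
      (∈-formulas≤ α k (m⊔n≤o⇒m≤o _ _ r)) (∈-formulas≤ β k (m⊔n≤o⇒n≤o _ _ r))))))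
  where L = formulas≤ k
∈-formulas≤ (α ∨ β) (suc k) (s≤s r) =
  ∈-++⁺ʳ (map var (List.upTo (suc k))) (∈-++⁺ʳ (map ¬_ L) (∈-++⁺ʳ (map O_ L)
    (∈-++⁺ʳ (cartesianProductWith _∧_ L L) (∈-++⁺ˡ (∈-cartesianProductWith⁺ _∨_
      (∈-formulas≤ α k (m⊔n≤o⇒m≤o _ _ r)) (∈-formulas≤ β k (m⊔n≤o⇒n≤o _ _ r)))))))
  where L = formulas≤ k
∈-formulas≤ (α ⇒ β) (suc k) (s≤s r) =
  ∈-++⁺ʳ (map var (List.upTo (suc k))) (∈-++⁺ʳ (map ¬_ L) (∈-++⁺ʳ (map O_ L)
    (∈-++⁺ʳ (cartesianProductWith _∧_ L L) (∈-++⁺ʳ (cartesianProductWith _∨_ L L)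
      (∈-cartesianProductWith⁺ _⇒_
        (∈-formulas≤ α k (m⊔n≤o⇒m≤o _ _ r)) (∈-formulas≤ β k (m⊔n≤o⇒n≤o _ _ r)))))))
  where L = formulas≤ k

-- Prime nontrivial theories

module Worlds (n : ℕ) where

  -- Membership is Boolean-valued so that worlds form a small type.
  record World : Set where
    field
      mem        : Formula → Bool
      ∋-thm      : ∀ {α} → ⊢[ n ] α → mem α ≡ true
      ∋-mp       : ∀ {α β} → mem (α ⇒ β) ≡ true → mem α ≡ true → mem β ≡ true
      prime      : ∀ {α β} → mem (α ∨ β) ≡ true → mem α ≡ true ⊎ mem β ≡ true
      nontrivial : ∃ λ α → mem α ≡ false

  open World public

  infix 4 _∋_ _∌_

  _∋_ _∌_ : World → Formula → Set
  w ∋ α = mem w α ≡ true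
  w ∌ α = mem w α ≡ false

  module _ (w : World) where

    ∋-ax : ∀ {α} → Axiom n α → w ∋ α
    ∋-ax = ∋-thm w ∘ axiom

    ∌-irrefl : ∀ {α} → w ∋ α → w ∌ α → ∀ {P : Set} → P
    ∌-irrefl p q = case trans (sym p) q of λ ()

    ∌-intro : ∀ {α} → (w ∋ α → w ∋ proj₁ (nontrivial w)) → w ∌ α
    ∌-intro f = Bool.¬-not λ p → ∌-irrefl (f p) (proj₂ (nontrivial w))

    ∋-∧⁺ : ∀ {α β} → w ∋ α → w ∋ β → w ∋ α ∧ β
    ∋-∧⁺ p q = ∋-mp w (∋-mp w (∋-ax (ax-∧I _ _)) p) q

    ∋-∧⁻ˡ : ∀ {α β} → w ∋ α ∧ β → w ∋ α
    ∋-∧⁻ˡ = ∋-mp w (∋-ax (ax-∧E₁ _ _))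

    ∋-∧⁻ʳ : ∀ {α β} → w ∋ α ∧ β → w ∋ β
    ∋-∧⁻ʳ = ∋-mp w (∋-ax (ax-∧E₂ _ _))

    mem-∧ : ∀ α β → mem w (α ∧ β) ≡ mem w α Bool.∧ mem w β
    mem-∧ α β with mem w α in p | mem w β in q
    ... | true  | true  = ∋-∧⁺ p q
    ... | true  | false = ∌-intro λ r → ∌-irrefl (∋-∧⁻ʳ r) q
    ... | false | _     = ∌-intro λ r → ∌-irrefl (∋-∧⁻ˡ r) p

    mem-∨ : ∀ α β → mem w (α ∨ β) ≡ mem w α Bool.∨ mem w β
    mem-∨ α β with mem w α in p | mem w β in q
    ... | true  | _     = ∋-mp w (∋-ax (ax-∨I₁ _ _)) p
    ... | false | true  = ∋-mp w (∋-ax (ax-∨I₂ _ _)) q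
    ... | false | false =
      ∌-intro λ r → [ (λ s → ∌-irrefl s p) , (λ s → ∌-irrefl s q) ]′ (prime w r)

    mem-⇒ : ∀ α β → mem w (α ⇒ β) ≡ mem w α ⊃ mem w β
    mem-⇒ α β with mem w α in p | mem w β in q
    ... | true  | true  = ∋-mp w (∋-ax (ax-K _ _)) q
    ... | true  | false = ∌-intro λ r → ∌-irrefl (∋-mp w r p) q
    -- Primeness applied to `α ∨ (α ⇒ β)` leaves only the implication once `α` is missing.
    ... | false | _     = [ (λ r → ∌-irrefl r p) , id ]′ (prime w (∋-ax (ax-∨⇒ α β)))

    ∌¬⇒∋ : ∀ {α} → w ∌ ¬ α → w ∋ α
    ∌¬⇒∋ p = [ id , (λ q → ∌-irrefl q p) ]′ (prime w (∋-ax (EM _)))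

    ∋¬¬⇒∋ : ∀ {α} → w ∋ ¬ ¬ α → w ∋ α
    ∋¬¬⇒∋ = ∋-mp w (∋-ax (cf _))

    -- `¬ (α ^ suc k)` is `¬ ¬ (α ^ k ∧ ¬ (α ^ k))`, so `cf` carries a contradiction one level down.
    contradictory-below : ∀ {α k} → w ∋ α ^ k ∧ ¬ (α ^ k) →
                          ∀ {i} → i ≤ k → w ∋ α ^ i ∧ ¬ (α ^ i)
    contradictory-below {k = zero}  p z≤n = p
    contradictory-below {k = suc k} p {i} i≤k with m≤n⇒m<n∨m≡n i≤k
    ... | inj₁ (s≤s i<k) = contradictory-below (∋¬¬⇒∋ (∋-∧⁻ʳ p)) i<k
    ... | inj₂ refl      = p

    ∋-^⟨⟩ : ∀ {α m} → 1 ≤ m → (∀ i → i < m → w ∋ α ^ suc i) → w ∋ α ^⟨ m ⟩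
    ∋-^⟨⟩ {m = suc zero}    _ f = f 0 (s≤s z≤n)
    ∋-^⟨⟩ {m = suc (suc m)} _ f =
      ∋-∧⁺ (∋-^⟨⟩ (s≤s z≤n) λ i i<m → f i (m≤n⇒m≤1+n i<m)) (f (suc m) ≤-refl)

    explosion : ∀ {α} → w ∋ α ^⟨ n ⟩ → w ∋ α → w ∌ ¬ α
    explosion p q = ∌-intro λ r → ∋-mp w (∋-mp w (∋-mp w (∋-ax (bc _ _)) p) q) r

  -- The index is unbounded on purpose: for positive `n`, `coord (suc n) α` is `α ^ n`, which lies
  -- just past the tuple and is the formula missing when all entries are true.
  coord : ℕ → Formula → Formula
  coord zero          α = α
  coord (suc zero)    α = ¬ α
  coord (suc (suc i)) α = α ^ suc i

  -- If `α ^ suc k` is missing, `EM` puts `α ^ k ∧ ¬ (α ^ k)` into `w`, and `contradictory-below`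
  -- supplies all earlier formulas.
  ∌coord⇒∋< : ∀ w {α j} → w ∌ coord j α → ∀ {i} → i < j → w ∋ coord i α
  ∌coord⇒∋< w {j = suc zero}    p {zero}        _ = ∌¬⇒∋ w p
  ∌coord⇒∋< w {j = suc zero}    p {suc i}       (s≤s ())
  ∌coord⇒∋< w {α} {suc (suc k)} p {i} i<j = go i i<j
    where
    below : ∀ {i} → i ≤ k → w ∋ α ^ i ∧ ¬ (α ^ i)
    below = contradictory-below w (∌¬⇒∋ w p)
    go : ∀ i → i < suc (suc k) → w ∋ coord i α
    go zero          _                = ∋-∧⁻ˡ w (below z≤n)
    go (suc zero)    _                = ∋-∧⁻ʳ w (below z≤n)
    go (suc (suc i)) (s≤s (s≤s i<k)) = ∋-∧⁻ˡ w (below i<k)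

  ∌coord⇒∋≢ : ∀ w {α j} → w ∌ coord j α → ∀ {i} → i ≢ j → w ∋ coord i α
  ∌coord⇒∋≢ w {α} {j} p {i} i≢j with <-cmp i j
  ... | tri< i<j _ _ = ∌coord⇒∋< w p i<j
  ... | tri≈ _ i≡j _ = contradiction i≡j i≢j
  ... | tri> _ _ j<i with mem w (coord i α) in q
  ...   | true  = refl
  ...   | false = ∌-irrefl w (∌coord⇒∋< w q j<i) p

-- Lindenbaum's lemma: extension to a prime theory avoiding a formula

module Lindenbaum (em : ExcludedMiddle 0ℓ) (n : ℕ) where

  open Derivations n
  open Worlds n

  module _ {Γ : Pred Formula 0ℓ} {φ : Formula} (Γ⊬φ : Nullary.¬ Γ ⊢ φ) where

    -- The test that `φ` stays underivable is part of the predicate, so the construction itself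
    -- makes no decision.
    adjoin : Pred Formula 0ℓ → Formula → Pred Formula 0ℓ
    adjoin Δ β α = α ∈ Δ ⊎ β ≡ α × Nullary.¬ (Δ ∪ ｛ β ｝ ⊢ φ)

    adjoin-⊬ : ∀ {Δ} β → Nullary.¬ Δ ⊢ φ → Nullary.¬ adjoin Δ β ⊢ φ
    adjoin-⊬ {Δ} β Δ⊬φ d with em {Δ ∪ ｛ β ｝ ⊢ φ}
    ... | yes e = Δ⊬φ (weaken (λ { (inj₁ p) → p ; (inj₂ (_ , c)) → contradiction e c }) d)
    ... | no c  = c (weaken (λ { (inj₁ p) → inj₁ p ; (inj₂ (q , _)) → inj₂ q }) d)

    adjoinAll : Pred Formula 0ℓ → List Formula → Pred Formula 0ℓ
    adjoinAll = foldl adjoin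

    adjoinAll-⊇ : ∀ {Δ} βs → Δ ⊆ adjoinAll Δ βs
    adjoinAll-⊇ []       p = p
    adjoinAll-⊇ (β ∷ βs) p = adjoinAll-⊇ βs (inj₁ p)

    adjoinAll-⊬ : ∀ {Δ} βs → Nullary.¬ Δ ⊢ φ → Nullary.¬ adjoinAll Δ βs ⊢ φ
    adjoinAll-⊬ []       c = c
    adjoinAll-⊬ (β ∷ βs) c = adjoinAll-⊬ βs (adjoin-⊬ β c)

    -- A rejected `β` derives `φ` when it is examined; the deduction theorem turns this into an
    -- implication that survives later additions.
    adjoinAll-decides : ∀ {Δ β} βs → β ∈ₗ βs → β ∈ adjoinAll Δ βs ⊎ adjoinAll Δ βs ⊢ β ⇒ φ
    adjoinAll-decides {Δ} {β} (.β ∷ βs) (here refl) with em {Δ ∪ ｛ β ｝ ⊢ φ}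
    ... | yes d = inj₂ (weaken (adjoinAll-⊇ βs ∘ inj₁) (deduction d))
    ... | no c  = inj₁ (adjoinAll-⊇ βs (inj₂ (refl , c)))
    adjoinAll-decides (_ ∷ βs) (there p) = adjoinAll-decides βs p

    stage : ℕ → Pred Formula 0ℓ
    stage zero    = Γ
    stage (suc k) = adjoinAll (stage k) (formulas≤ k)

    stage-mono : ∀ {k l} → k ≤ l → stage k ⊆ stage l
    stage-mono {l = zero}  z≤n p = p
    stage-mono {l = suc l} k≤l p with m≤n⇒m<n∨m≡n k≤l
    ... | inj₁ (s≤s k≤l′) = adjoinAll-⊇ (formulas≤ l) (stage-mono k≤l′ p)
    ... | inj₂ refl       = p

    stage-⊬ : ∀ k → Nullary.¬ stage k ⊢ φ
    stage-⊬ zero    = Γ⊬φ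
    stage-⊬ (suc k) = adjoinAll-⊬ (formulas≤ k) (stage-⊬ k)

    limit : Pred Formula 0ℓ
    limit α = ∃ λ k → α ∈ stage k

    limit-compact : ∀ {α} → limit ⊢ α → ∃ λ k → stage k ⊢ α
    limit-compact (hyp (k , p)) = k , hyp p
    limit-compact (thm t)       = 0 , thm t
    limit-compact (mp d e) with limit-compact d | limit-compact e
    ... | k , d′ | l , e′ =
      k ⊔ l , mp (weaken (stage-mono (m≤m⊔n k l)) d′) (weaken (stage-mono (m≤n⊔m k l)) e′)

    limit-⊬ : Nullary.¬ limit ⊢ φ
    limit-⊬ d with limit-compact d
    ... | k , d′ = stage-⊬ k d′

    -- Maximality relative to `φ`: every `β` has been examined by stage `suc (rank β)`. Both closure
    -- and primeness of the limit follow from it.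
    ∉limit⇒⊢⇒ : ∀ {β} → β ∉ limit → limit ⊢ β ⇒ φ
    ∉limit⇒⊢⇒ {β} β∉ with
      adjoinAll-decides {stage (rank β)} (formulas≤ (rank β)) (∈-formulas≤ β _ ≤-refl)
    ... | inj₁ p = contradiction (suc (rank β) , p) β∉
    ... | inj₂ d = weaken (suc (rank β) ,_) d

    limit-closed : ∀ {β} → limit ⊢ β → β ∈ limit
    limit-closed {β} d with em {β ∈ limit}
    ... | yes p = p
    ... | no c  = contradiction (mp (∉limit⇒⊢⇒ c) d) limit-⊬

    limit-prime : ∀ {α β} → α ∨ β ∈ limit → α ∈ limit ⊎ β ∈ limit
    limit-prime {α} {β} p with em {α ∈ limit} | em {β ∈ limit}
    ... | yes q | _     = inj₁ q
    ... | no _  | yes q = inj₂ q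
    ... | no a  | no b  = contradiction
      (mp (mp (mp (ax (ax-∨E α β φ)) (∉limit⇒⊢⇒ a)) (∉limit⇒⊢⇒ b)) (hyp p)) limit-⊬

    private
      ∈⇒true : ∀ {α} → α ∈ limit → does (em {α ∈ limit}) ≡ true
      ∈⇒true = dec-true em

      true⇒∈ : ∀ {α} → does (em {α ∈ limit}) ≡ true → α ∈ limit
      true⇒∈ {α} _ with yes p ← em {α ∈ limit} = p

    lindenbaum : ∃ λ w → (∀ {α} → α ∈ Γ → w ∋ α) × w ∌ φ
    lindenbaum = w , (λ p → ∈⇒true (0 , p)) , φ∌
      where
      φ∌ : does (em {φ ∈ limit}) ≡ false
      φ∌ = dec-false em (limit-⊬ ∘ hyp)
      w : World
      w = record
        { mem        = λ α → does (em {α ∈ limit})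
        ; ∋-thm      = λ t → ∈⇒true (limit-closed (thm t))
        ; ∋-mp       = λ p q → ∈⇒true (limit-closed (mp (hyp (true⇒∈ p)) (hyp (true⇒∈ q))))
        ; prime      = λ p → Sum.map ∈⇒true ∈⇒true (limit-prime (true⇒∈ p))
        ; nontrivial = φ , φ∌
        }

-- The canonical model: accessibility, values and the model conditions

module Canonical (em : ExcludedMiddle 0ℓ) (n : ℕ) (2≤n : 2 ≤ n) where

  open Derivations n
  open Worlds n
  open Lindenbaum em n
  open Semantics n 2≤n

  _↝_ : World → World → Set
  w ↝ u = ∀ {α} → w ∋ O α → u ∋ α

  -- `O-nec` covers theorems and `K` covers modus ponens. Hence, if `O α` is missing, the unboxed
  -- formulas do not derive `α` and extend to a successor without it.
  unboxed-closed : ∀ w {α} → (λ β → w ∋ O β) ⊢ α → w ∋ O α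
  unboxed-closed w (hyp p)  = p
  unboxed-closed w (thm t)  = ∋-thm w (O-nec t)
  unboxed-closed w (mp d e) =
    ∋-mp w (∋-mp w (∋-ax w (K _ _)) (unboxed-closed w d)) (unboxed-closed w e)

  ∌O⇒successor : ∀ w {α} → w ∌ O α → ∃ λ u → w ↝ u × u ∌ α
  ∌O⇒successor w p with lindenbaum (λ d → ∌-irrefl w (unboxed-closed w d) p)
  ... | u , w↝u , q = u , w↝u , q

  -- O α and O ∼ α are not both in w, by D and bc; a missing O β gives a successor.
  ↝-serial : ∀ w → ∃ λ u → w ↝ u
  ↝-serial w with mem w (O (var 0)) in p
  ... | false = let u , w↝u , _ = ∌O⇒successor w p in u , w↝u
  ... | true with mem w (O (∼⟨ n ⟩ var 0)) in q
  ...   | false = let u , w↝u , _ = ∌O⇒successor w q in u , w↝u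
  ...   | true  = ∌-irrefl w (∋-∧⁻ˡ w r) (explosion w (∋-∧⁻ʳ w r) q)
    where r = ∋-mp w (∋-ax w (D _)) p

  value : World → Formula → Tuple
  value w α = tabulate λ j → mem w (coord (toℕ j) α)

  -- At most one formula of the sequence is missing. For `m` beyond `n` both sides are the all-true
  -- tuple.
  value-zeroAt : ∀ w α m → w ∌ coord m α → value w α ≡ zeroAt m
  value-zeroAt w α m p = tabulate-cong λ j → go (toℕ j)
    where
    go : ∀ i → mem w (coord i α) ≡ not (i ≡ᵇ m)
    go i with i ≟ m
    -- `does (i ≟ m)` computes to `i ≡ᵇ m`.
    ... | yes refl = trans p (sym (cong not (dec-true (i ≟ i) refl)))
    ... | no i≢m   = trans (∌coord⇒∋≢ w p i≢m) (sym (cong not (dec-false (i ≟ m) i≢m)))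

  lookup-tabulate-fromℕ< : ∀ (f : ℕ → Bool) {i} (i<1+n : i < suc n) →
                           lookup (tabulate (f ∘ toℕ)) (fromℕ< i<1+n) ≡ f i
  lookup-tabulate-fromℕ< f i<1+n =
    trans (lookup∘tabulate (f ∘ toℕ) (fromℕ< i<1+n)) (cong f (toℕ-fromℕ< i<1+n))

  zeroAt-value : ∀ w α m → value w α ≡ zeroAt m →
                 ∀ {i} → i ≤ n → mem w (coord i α) ≡ not (i ≡ᵇ m)
  zeroAt-value w α m p {i} i≤n =
    trans (sym (lookup-tabulate-fromℕ< (λ i → mem w (coord i α)) (s≤s i≤n)))
      (trans (cong (λ a → lookup a (fromℕ< (s≤s i≤n))) p)
        (lookup-tabulate-fromℕ< (λ i → not (i ≡ᵇ m)) (s≤s i≤n)))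

  second-value : ∀ w α → second (value w α) ≡ mem w (¬ α)
  second-value w α = lookup-tabulate-fromℕ< (λ i → mem w (coord i α)) {1} (s≤s (<⇒≤ 2≤n))

  ∋⇒value≢F : ∀ w {α} → w ∋ α → value w α ≢ F
  ∋⇒value≢F w p eq = ∌-irrefl w p (cong head eq)

  value≢T : ∀ w {α} → w ∋ ¬ α → value w α ≢ T
  value≢T w {α} p eq = ∌-irrefl w p (zeroAt-value w α 1 eq (<⇒≤ 2≤n))

  and-take-tabulate : ∀ {m} k (f : Fin m → Bool) → (∀ j → toℕ j < k → f j ≡ true) →
                      and (List.take k (toList (tabulate f))) ≡ true
  and-take-tabulate             zero    f p = refl
  and-take-tabulate {m = zero}  (suc k) f p = refl
  and-take-tabulate {m = suc m} (suc k) f p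
    rewrite p Fin.zero (s≤s z≤n) =
    and-take-tabulate k (f ∘ Fin.suc) λ j j<k → p (Fin.suc j) (s≤s j<k)

  -- Membership in `A` means that a false entry has only true entries before it, which is
  -- `∌coord⇒∋<`.
  value∈A : ∀ w α → value w α ∈ A
  value∈A w α k with mem w (coord (suc (toℕ k)) α) in p
  ... | true  rewrite lookup∘tabulate (λ j → mem w (coord (toℕ j) α)) (Fin.suc k) | p = Bool.∨-zeroʳ _
  ... | false = cong (Bool._∨ lookup (value w α) (Fin.suc k)) (and-take-tabulate (suc (toℕ k))
                  (λ j → mem w (coord (toℕ j) α)) λ j j≤k → ∌coord⇒∋< w p j≤k)

  ∌∧¬⇒Boo : ∀ w {α} → w ∌ α ∧ ¬ α → value w α ∈ Boo
  ∌∧¬⇒Boo w {α} p with mem w α Bool.≟ false | mem w (¬ α) Bool.≟ false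
  ... | yes q | _     = inj₂ (value-zeroAt w α 0 q)
  ... | no _  | yes r = inj₁ (value-zeroAt w α 1 r)
  ... | no q  | no r  = ∌-irrefl w (∋-∧⁺ w (Bool.¬-not q) (Bool.¬-not r)) p

  -- By `bc`, `α` and `¬ α` cannot both be in `w`. With the converse below, `P` and `PO` become
  -- statements about Boolean values.
  ∋^⟨⟩⇒Boo : ∀ w {α} → w ∋ α ^⟨ n ⟩ → value w α ∈ Boo
  ∋^⟨⟩⇒Boo w p = ∌∧¬⇒Boo w (∌-intro w λ q →
    ∌-irrefl w (∋-∧⁻ʳ w q) (explosion w p (∋-∧⁻ˡ w q)))

  Boo⇒∋^⟨⟩ : ∀ w {α} → value w α ∈ Boo → w ∋ α ^⟨ n ⟩
  Boo⇒∋^⟨⟩ w {α} (inj₁ p) = ∋-^⟨⟩ w (<⇒≤ 2≤n) λ i _ →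
    ∌coord⇒∋≢ w {j = 1} (zeroAt-value w α 1 p (<⇒≤ 2≤n)) {suc (suc i)} λ ()
  Boo⇒∋^⟨⟩ w {α} (inj₂ p) = ∋-^⟨⟩ w (<⇒≤ 2≤n) λ i _ →
    ∌coord⇒∋≢ w {j = 0} (zeroAt-value w α 0 p z≤n) {suc (suc i)} λ ()

  if-dec⁺ : ∀ {P : Set} (P? : Nullary.Dec P) {X Y : Pred Tuple 0ℓ} {c} →
            (P → c ∈ X) → c ∈ Y → c ∈ (if does P? then X else Y)
  if-dec⁺ (yes p) f _ = f p
  if-dec⁺ (no _)  _ y = y

  -- One argument serves all three connectives; the last hypothesis selects the conjunct of the
  -- conclusion of `P` that concerns `γ`.
  value-multi : ∀ w α β γ _∗_ → mem w γ ≡ mem w α ∗ mem w β →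
                (w ∋ (α ⇒ β) ^⟨ n ⟩ ∧ (α ∨ β) ^⟨ n ⟩ ∧ (α ∧ β) ^⟨ n ⟩ → w ∋ γ ^⟨ n ⟩) →
                value w γ ∈ multi _∗_ (value w α) (value w β)
  value-multi w α β γ _ eq f =
    if-dec⁺ (Boo? (value w α) ×-dec Boo? (value w β)) {Boo} {A}
      (λ (p , q) → ∋^⟨⟩⇒Boo w (f (∋-mp w (∋-ax w (P α β)) (∋-∧⁺ w (Boo⇒∋^⟨⟩ w p) (Boo⇒∋^⟨⟩ w q)))))
      (value∈A w γ) , eq

  ⇒-≤ : ∀ {a b} → (a ≡ true → b ≡ true) → a Bool.≤ b
  ⇒-≤ {false} f = Bool.≤-minimum _
  ⇒-≤ {true}  f = Bool.≤-reflexive (sym (f refl))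

  value-O : ∀ w α → value w (O α) ∈ Õ (λ x → ∃ λ u → w ↝ u × x ≡ value u α)
  value-O w α = value∈A w (O α) ,
    (λ { (_ , (_ , w↝u , refl) , refl) → ⇒-≤ w↝u }) , greatest
    where
    greatest : ∀ {l} →
               (∀ {s} → (∃ λ x → (∃ λ u → w ↝ u × x ≡ value u α) × s ≡ first x) → l Bool.≤ s) →
               l Bool.≤ mem w (O α)
    greatest l≤ with mem w (O α) in p
    ... | true  = Bool.≤-maximum _
    -- Some successor misses `α`, so a lower bound of the first coordinates must be false.
    ... | false with ∌O⇒successor w p
    ...   | u , w↝u , q = subst (_ Bool.≤_) q (l≤ (_ , (u , w↝u , refl) , refl))

  -- `coord 2 α` and `coord 1 (α ∧ ¬ α)` are the same formula, `¬ (α ∧ ¬ α)`.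
  value-t₀ : ∀ w α → value w α ≡ t 0 → value w (α ∧ ¬ α) ≡ T
  value-t₀ w α p = value-zeroAt w (α ∧ ¬ α) 1 (zeroAt-value w α 2 p 2≤n)

  value-t⇒∌ : ∀ w α k → k < n → value w α ≡ t k → w ∌ α ^ suc k
  value-t⇒∌ w α k k<n p with suc (suc k) ≤? n
  ... | yes k+2≤n = 
    trans (zeroAt-value w α (suc (suc k)) p k+2≤n) (cong not (dec-true (k ≟ k) refl))
  -- Here α, ¬ α, α ^ 1, …, α ^ k are in w and n = k + 1; α ^ n ∈ w would contradict bc.
  ... | no k+2≰n  = ∌-intro w λ q →
    ∌-irrefl w (below 1 1≤n (λ ())) (explosion w (∋-^⟨⟩ w 1≤n (powers q)) (below 0 z≤n λ ()))
    where
    1≤n = <⇒≤ 2≤n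
    below : ∀ i → i ≤ n → i ≢ suc (suc k) → w ∋ coord i α
    below i i≤n i≢ = 
      trans (zeroAt-value w α (suc (suc k)) p i≤n) (cong not (dec-false (i ≟ suc (suc k)) i≢))
    powers : w ∋ α ^ suc k → ∀ i → i < n → w ∋ α ^ suc i
    powers q i i<n with i ≟ k
    ... | yes refl = q
    ... | no i≢k   = below (suc (suc i)) (≤-trans (s≤s (≤∧≢⇒< i≤k i≢k)) k<n) λ { refl → i≢k refl }
      where i≤k = s≤s⁻¹ (≤-trans i<n (s≤s⁻¹ (≰⇒> k+2≰n)))

  value-tₖ : ∀ w α k → suc k < n → value w α ≡ t (suc k) →
             value w (α ∧ ¬ α) ∈ Inconsistent × value w (α ^ 1) ≡ t k
  value-tₖ w α k k+1<n p =
    -- Only `α ^ suc (suc k)` is missing. Index 2 gives `α ^ 1`, the negation of `α ∧ ¬ α`; indices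
    -- 0 and 1 give the two conjuncts.
    (value∈A w _ , value≢T w (in-w 2 λ ()) , ∋⇒value≢F w (∋-∧⁺ w (in-w 0 λ ()) (in-w 1 λ ()))) ,
    value-zeroAt w (α ^ 1) (suc (suc k)) (subst (w ∌_) (sym (^-suc α (suc k))) α^∌)
    where
    α^∌ : w ∌ α ^ suc (suc k)
    α^∌ = value-t⇒∌ w α (suc k) k+1<n p
    in-w : ∀ i → i ≢ suc (suc (suc k)) → w ∋ coord i α
    in-w i = ∌coord⇒∋≢ w {j = suc (suc (suc k))} α^∌ {i}

  model : World → Model
  model w₀ = record
    { W        = World
    ; nonempty = w₀
    ; R        = _↝_
    ; serial   = ↝-serial
    ; v        = value
    ; v∈A      = value∈A
    -- The inequality says that `¬ ¬ α` in `w` puts `α` in `w`, which is `cf`.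
    ; v-¬      = λ w α → value∈A w (¬ α) , sym (second-value w α) ,
                   subst (Bool._≤ mem w α) (sym (second-value w (¬ α))) (⇒-≤ (∋¬¬⇒∋ w))
    ; v-∧      = λ w α β → value-multi w α β (α ∧ β) Bool._∧_ (mem-∧ w α β) (∋-∧⁻ʳ w)
    ; v-∨      = λ w α β → value-multi w α β (α ∨ β) Bool._∨_ (mem-∨ w α β) (∋-∧⁻ʳ w ∘ ∋-∧⁻ˡ w)
    ; v-⇒      = λ w α β → value-multi w α β (α ⇒ β) _⊃_ (mem-⇒ w α β) (∋-∧⁻ˡ w ∘ ∋-∧⁻ˡ w)
    ; v-O      = value-O
    ; v-t₀     = value-t₀
    ; v-tₖ     = value-tₖ
    ; v-Boo    = λ w α p → ∋^⟨⟩⇒Boo w (∋-mp w (∋-ax w (PO α)) (Boo⇒∋^⟨⟩ w p))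
    }

-- Completeness

theorem7p17 : ExcludedMiddle 0ℓ →
    (n : ℕ) (2≤n : 2 ≤ n) (Γ : Pred Formula 0ℓ) (φ : Formula) →
    let open Semantics n 2≤n in
    Γ ⊨ φ → Γ ⊢[ n ] φ
theorem7p17 em n 2≤n Γ φ Γ⊨φ with em {Derivations._⊢_ n Γ φ}
... | yes Γ⊢φ = Derivations.⊢⇒⊢[] n Γ⊢φ
... | no Γ⊬φ with Lindenbaum.lindenbaum em n Γ⊬φ
-- A missing `φ` has value `zeroAt 0`, which is `F`, whereas `φ` must be designated at `w`.
...   | w , Γ⊆w , w∌φ = contradiction (value-zeroAt w φ 0 w∌φ) (proj₂ w⊩φ)
  where
  open Canonical em n 2≤n
  w⊩φ = Γ⊨φ (model w) w λ γ γ∈Γ → value∈A w γ , ∋⇒value≢F w (Γ⊆w γ∈Γ)
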